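{- Let $\mathsf{CS}$ be an axiomatically appropriate constant specification for $\mathsf{Base}$. For any formula $A\in\mathcal{L}_{\mathsf J}$: if $\vDash_{\mathsf m}A$ (i.e. $A$ is true at every world of every intuitionistic modular model) then $\vdash_{\mathsf{JIK}_{\mathsf{CS}}}A$.
   Context: **Justification language.** Fix countable sets $\mathsf{Prop}$ (propositional variables), $\mathsf{PrfConst}$ (proof constants), $\mathsf{PrfVar}$ (proof variables), $\mathsf{SatVar}$ (satisfier variables). Proof terms $t\in\mathsf{PrfTm}$ and satisfier terms $m\in\mathsf{SatTm}$ are defined by mutual induction: $t ::= c\in\mathsf{PrfConst}\mid x\in\mathsf{PrfVar}\mid t\cdot t\mid t+t\mid {!t}\mid m\triangleright t$ and $m ::= a\in\mathsf{SatVar}\mid m\sqcup m\mid t\star m$. The justification language $\mathcal{L}_{\mathsf J}$ is $A ::= p\in\mathsf{Prop}\mid\bot\mid A\wedge A\mid A\vee A\mid A\to A\mid [t]A\mid\langle m\rangle A$. **The logic $\mathsf{JIK}_{\mathsf{CS}}$.** Let $\mathsf{Int}$ be a finite set of axiom (schemes) for intuitionistic propositional logic (complete with modus ponens). The axiom set $\mathsf{Base}$ is $\mathsf{Int}$ (over $\mathcal{L}_{\mathsf J}$) together with: $[s](A\to B)\to([t]A\to[s\cdot t]B)$; $[s](A\to B)\to(\langle m\rangle A\to\langle s\star m\rangle B)$; $\langle m\rangle(A\vee B)\to(\langle m\rangle A\vee\langle m\rangle B)$; $(\langle m\rangle A\to[t]B)\to[m\triangleright t](A\to B)$; $\langle m\rangle\bot\to\bot$;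 $[s]A\to[s+t]A$; $[t]A\to[s+t]A$; $\langle m\rangle A\to\langle m\sqcup n\rangle A$; $\langle n\rangle A\to\langle m\sqcup n\rangle A$. A constant specification $\mathsf{CS}$ is any set of formulas $[c]A$ with $c\in\mathsf{PrfConst}$ and $A$ an axiom instance of $\mathsf{Base}$; it is axiomatically appropriate if for each axiom instance $A$ of $\mathsf{Base}$ there is $c$ with $[c]A\in\mathsf{CS}$. For finite $\Gamma$, $\Gamma\vdash_{\mathsf{JIK}_{\mathsf{CS}}}A$ means $\Gamma\vdash A$ is derivable with: ($\mathsf{ax}$) $\Gamma\vdash A$ for $A$ an axiom instance of $\mathsf{Base}$; ($\mathsf{id}$) $\Gamma\vdash A$ for $A\in\Gamma$; ($\mathsf{mp}$) from $\Gamma\vdash A$ and $\Gamma\vdash A\to B$ infer $\Gamma\vdash B$; ($\mathsf{can}$) $\Gamma\vdash[!^k c]\cdots[!c][c]A$ for any $[c]A\in\mathsf{CS}$ and $k\ge 0$, where $!^k c$ is $k$-fold application of $!$ to $c$. $\vdash_{\mathsf{JIK}_{\mathsf{CS}}}A$ means $\emptyset\vdash_{\mathsf{JIK}_{\mathsf{CS}}}A$. **Basic models.** For sets of formulas $X,Y$ let $X\cdot Y:=\{B\mid A\to B\in X\text{ and }A\in Y\text{ for some }A\}$. A basic (intuitionistic modular) model (for $\mathsf{CS}$) is a tuple $\mathcal B=(W,\le,*)$ with $W$ a non-empty set, $\le$ a preorder on $W$, and $*$ assigning to each $p\in\mathsf{Prop}$ and $w\in W$ a value $p^*_w\in\{0,1\}$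 and to each proof or satisfier term $s$ and $w\in W$ a set of formulas $s^*_w\subseteq\mathcal{L}_{\mathsf J}$, such that for all $w\in W$, proof terms $s,t$, satisfier terms $m,n$ and formulas $A,B$: (M1) if $w\le v$ and $p^*_w=1$ then $p^*_v=1$; (M2) if $w\le v$ then $t^*_w\subseteq t^*_v$ and $m^*_w\subseteq m^*_v$; (1) $s^*_w\cdot t^*_w\subseteq(s\cdot t)^*_w$; (2) $s^*_w\cdot m^*_w\subseteq(s\star m)^*_w$; (3) $s^*_w\cup t^*_w\subseteq(s+t)^*_w$; (4) $m^*_w\cup n^*_w\subseteq(m\sqcup n)^*_w$; (5) $A\in t^*_w$ for any formula $[t]A$ that is a conclusion of $\mathsf{can}$; (6) if $A\vee B\in m^*_w$ then $A\in m^*_w$ or $B\in m^*_w$; (7) if for all $v\ge w$, $A\notin m^*_v$ or $B\in t^*_v$, then $A\to B\in(m\triangleright t)^*_w$; (8) $\bot\notin m^*_w$. **Truth in basic models.** $\mathcal B,w\Vdash p$ iff $p^*_w=1$; never $\mathcal B,w\Vdash\bot$; $\wedge,\vee$ are evaluated pointwise; $\mathcal B,w\Vdash A\to B$ iff for all $v\ge w$, $\mathcal B,v\Vdash A$ implies $\mathcal B,v\Vdash B$; $\mathcal B,w\Vdash[t]A$ iff $A\in t^*_w$; $\mathcal B,w\Vdash\langle m\rangle A$ iff $A\in m^*_w$. **Modular models.** A quasi-model is a tuple $\mathcal M=(W,\le,R,*)$ where $\mathcal B=(W,\le,*)$ is a basic model and $R$ is a binary relation on $W$; truth is $\mathcal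 M,w\Vdash A$ iff $\mathcal B,w\Vdash A$. An intuitionistic modular model is a quasi-model $\mathcal M=(W,\le,R,*)$ such that $(W,\le,R,*|_{\mathsf{Prop}})$ is a birelational model, i.e. $*|_{\mathsf{Prop}}$ is monotone along $\le$ and (BC) if $w\,R\,v\le v'$ then there is $w'$ with $w\le w'\,R\,v'$, (FC) if $w\le w'$ and $w\,R\,v$ then there is $v'$ with $w'\,R\,v'$ and $v\le v'$; and moreover, for all $w\in W$: (JYB) for every proof term $t$ and every $A\in t^*_w$, for all $w',v'$ with $w\le w'\,R\,v'$ we have $\mathcal M,v'\Vdash A$; (SYP) for every satisfier term $m$ and every $A\in m^*_w$, there is $v$ with $w\,R\,v$ and $\mathcal M,v\Vdash A$. $\vDash_{\mathsf m}A$ means $\mathcal M,w\Vdash A$ for every intuitionistic modular model $\mathcal M$ and every $w\in W$. -}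

module Defs where

open import Data.Bool using (Bool; true)
open import Data.Empty using (⊥)
open import Data.List using (List; []; _∷_)
open import Data.List.Membership.Propositional using () renaming (_∈_ to _∈ˡ_)
open import Data.Nat using (ℕ; zero; suc)
open import Data.Product using (∃-syntax; _×_)
open import Data.Sum using (_⊎_)
open import Function.Bundles using (_↣_; _⇔_)
open import Level using (0ℓ)
open import Relation.Binary.Core using (Rel)
open import Relation.Binary.PropositionalEquality using (_≡_)
open import Relation.Binary.Structures using (IsPreorder)
open import Relation.Nullary using (¬_)
open import Relation.Unary using (Pred; _∈_; _∉_; _⊆_; _∪_)

------------------------------------------------------------------------
-- Intuitionistic propositional logic

-- A scheme is a propositional formula over metavariables indexed by ℕ.
data Scheme : Set where
  meta        : ℕ → Scheme
  ⊥ᶠ          : Scheme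
  _∧_ _∨_ _⇒_ : Scheme → Scheme → Scheme

infixr 7 _∧_
infixr 6 _∨_
infixr 5 _⇒_

_⟦_⟧ : Scheme → (ℕ → Scheme) → Scheme
meta i  ⟦ σ ⟧ = σ i
⊥ᶠ      ⟦ σ ⟧ = ⊥ᶠ
(φ ∧ ψ) ⟦ σ ⟧ = φ ⟦ σ ⟧ ∧ ψ ⟦ σ ⟧
(φ ∨ ψ) ⟦ σ ⟧ = φ ⟦ σ ⟧ ∨ ψ ⟦ σ ⟧
(φ ⇒ ψ) ⟦ σ ⟧ = φ ⟦ σ ⟧ ⇒ ψ ⟦ σ ⟧

infix 8 _⟦_⟧
infix 3 _⊢ₙ_ _⊢ₕ_

-- Gentzen's natural deduction NJ, the reference presentation of
-- intuitionistic propositional logic.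
data _⊢ₙ_ (Γ : List Scheme) : Scheme → Set where
  hyp  : ∀ {φ} → φ ∈ˡ Γ → Γ ⊢ₙ φ
  ⊥-e  : ∀ {φ} → Γ ⊢ₙ ⊥ᶠ → Γ ⊢ₙ φ
  ∧-i  : ∀ {φ ψ} → Γ ⊢ₙ φ → Γ ⊢ₙ ψ → Γ ⊢ₙ φ ∧ ψ
  ∧-e₁ : ∀ {φ ψ} → Γ ⊢ₙ φ ∧ ψ → Γ ⊢ₙ φ
  ∧-e₂ : ∀ {φ ψ} → Γ ⊢ₙ φ ∧ ψ → Γ ⊢ₙ ψ
  ∨-i₁ : ∀ {φ ψ} → Γ ⊢ₙ φ → Γ ⊢ₙ φ ∨ ψ
  ∨-i₂ : ∀ {φ ψ} → Γ ⊢ₙ ψ → Γ ⊢ₙ φ ∨ ψ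
  ∨-e  : ∀ {φ ψ χ} → Γ ⊢ₙ φ ∨ ψ → φ ∷ Γ ⊢ₙ χ → ψ ∷ Γ ⊢ₙ χ → Γ ⊢ₙ χ
  ⇒-i  : ∀ {φ ψ} → φ ∷ Γ ⊢ₙ ψ → Γ ⊢ₙ φ ⇒ ψ
  ⇒-e  : ∀ {φ ψ} → Γ ⊢ₙ φ ⇒ ψ → Γ ⊢ₙ φ → Γ ⊢ₙ ψ

-- Int ⊢ₕ φ: φ follows by modus ponens from instances of the schemes Int.
data _⊢ₕ_ (Int : List Scheme) : Scheme → Set where
  ax : ∀ {φ} → φ ∈ˡ Int → (σ : ℕ → Scheme) → Int ⊢ₕ φ ⟦ σ ⟧
  mp : ∀ {φ ψ} → Int ⊢ₕ φ → Int ⊢ₕ φ ⇒ ψ → Int ⊢ₕ ψ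

-- The finite list Int axiomatises intuitionistic propositional logic:
-- with modus ponens as only rule it is sound and complete for it.
AxiomatisesIPL : List Scheme → Set
AxiomatisesIPL Int = ∀ φ → (Int ⊢ₕ φ) ⇔ ([] ⊢ₙ φ)

------------------------------------------------------------------------
-- Syntax of justification logic

-- Countable means finite (possibly empty) or countably infinite.
record Signature : Set₁ where
  field
    PropVar PrfConst PrfVar SatVar : Set
    PropVar-countable  : PropVar  ↣ ℕ
    PrfConst-countable : PrfConst ↣ ℕ
    PrfVar-countable   : PrfVar   ↣ ℕ
    SatVar-countable   : SatVar   ↣ ℕ

module Language (𝒮 : Signature) where
  open Signature 𝒮

  infixl 8 _·_ _⋆_
  infixl 7 _+_ _⊔_
  infixr 7 _▷_
  infix  9 !_

  mutual
    data PrfTm : Set where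
      con : PrfConst → PrfTm
      var : PrfVar → PrfTm
      _·_ : PrfTm → PrfTm → PrfTm
      _+_ : PrfTm → PrfTm → PrfTm
      !_  : PrfTm → PrfTm
      _▷_ : SatTm → PrfTm → PrfTm

    data SatTm : Set where
      var : SatVar → SatTm
      _⊔_ : SatTm → SatTm → SatTm
      _⋆_ : PrfTm → SatTm → SatTm

  infix  9 [_]_ ⟨_⟩_
  infixr 7 _∧_
  infixr 6 _∨_
  infixr 5 _⇒_

  data Formula : Set where
    atom        : PropVar → Formula
    ⊥ᶠ          : Formula
    _∧_ _∨_ _⇒_ : Formula → Formula → Formula
    [_]_        : PrfTm → Formula → Formula
    ⟨_⟩_        : SatTm → Formula → Formula

  instantiate : (ℕ → Formula) → Scheme → Formula
  instantiate σ (meta i) = σ i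
  instantiate σ ⊥ᶠ       = ⊥ᶠ
  instantiate σ (φ ∧ ψ)  = instantiate σ φ ∧ instantiate σ ψ
  instantiate σ (φ ∨ ψ)  = instantiate σ φ ∨ instantiate σ ψ
  instantiate σ (φ ⇒ ψ)  = instantiate σ φ ⇒ instantiate σ ψ

  !^ : ℕ → PrfTm → PrfTm
  !^ zero    t = t
  !^ (suc k) t = ! (!^ k t)

  -- [!ᵏ c] ⋯ [! c] [c] A
  canF : ℕ → PrfConst → Formula → Formula
  canF zero    c A = [ con c ] A
  canF (suc k) c A = [ !^ (suc k) (con c) ] canF k c A

  ----------------------------------------------------------------------
  -- The logic JIK_CS

  -- Axiom instances of Base.
  data Base (Int : List Scheme) : Pred Formula 0ℓ where
    int   : ∀ {φ} → φ ∈ˡ Int → (σ : ℕ → Formula) → instantiate σ φ ∈ Base Int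
    k□    : ∀ s t A B → [ s ] (A ⇒ B) ⇒ ([ t ] A ⇒ [ s · t ] B) ∈ Base Int
    k◇    : ∀ s m A B → [ s ] (A ⇒ B) ⇒ (⟨ m ⟩ A ⇒ ⟨ s ⋆ m ⟩ B) ∈ Base Int
    ◇∨    : ∀ m A B → ⟨ m ⟩ (A ∨ B) ⇒ (⟨ m ⟩ A ∨ ⟨ m ⟩ B) ∈ Base Int
    ◇⇒□   : ∀ m t A B → (⟨ m ⟩ A ⇒ [ t ] B) ⇒ [ m ▷ t ] (A ⇒ B) ∈ Base Int
    ◇⊥    : ∀ m → ⟨ m ⟩ ⊥ᶠ ⇒ ⊥ᶠ ∈ Base Int
    sumˡ  : ∀ s t A → [ s ] A ⇒ [ s + t ] A ∈ Base Int
    sumʳ  : ∀ s t A → [ t ] A ⇒ [ s + t ] A ∈ Base Int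
    joinˡ : ∀ m n A → ⟨ m ⟩ A ⇒ ⟨ m ⊔ n ⟩ A ∈ Base Int
    joinʳ : ∀ m n A → ⟨ n ⟩ A ⇒ ⟨ m ⊔ n ⟩ A ∈ Base Int

  IsConstantSpecification : List Scheme → Pred Formula 0ℓ → Set
  IsConstantSpecification Int CS =
    ∀ {F} → F ∈ CS → ∃[ c ] ∃[ A ] (F ≡ [ con c ] A × A ∈ Base Int)

  AxiomaticallyAppropriate : List Scheme → Pred Formula 0ℓ → Set
  AxiomaticallyAppropriate Int CS =
    ∀ {A} → A ∈ Base Int → ∃[ c ] [ con c ] A ∈ CS

  -- Conclusions of the rule can.
  data Can (CS : Pred Formula 0ℓ) : Pred Formula 0ℓ where
    can : ∀ {c A} → [ con c ] A ∈ CS → (k : ℕ) → canF k c A ∈ Can CS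

  module JIK (Int : List Scheme) (CS : Pred Formula 0ℓ) where

    infix 3 _⊢_

    data _⊢_ (Γ : List Formula) : Formula → Set where
      ax  : ∀ {A} → A ∈ Base Int → Γ ⊢ A
      id  : ∀ {A} → A ∈ˡ Γ → Γ ⊢ A
      mp  : ∀ {A B} → Γ ⊢ A → Γ ⊢ A ⇒ B → Γ ⊢ B
      can : ∀ {A} → A ∈ Can CS → Γ ⊢ A

  ----------------------------------------------------------------------
  -- Basic models

  _⊙_ : Pred Formula 0ℓ → Pred Formula 0ℓ → Pred Formula 0ℓ
  (X ⊙ Y) B = ∃[ A ] (A ⇒ B ∈ X × A ∈ Y)

  -- Sets of formulas are Set-valued predicates, whereas val is Bool-valued.
  -- The metatheory of the source is classical: the results about these
  -- models take excluded middle at level 0ℓ as an explicit hypothesis,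
  -- under which such predicates are also decidable.

  -- The interpretation * is split by syntactic sort: val p w, prf t w and
  -- sat m w stand for its values at p, t and m in the world w.
  record BasicModel (CS : Pred Formula 0ℓ) : Set₁ where
    infix 4 _≤_
    field
      W          : Set
      inhabitant : W
      _≤_        : Rel W 0ℓ
      isPreorder : IsPreorder _≡_ _≤_
      val        : PropVar → W → Bool
      prf        : PrfTm → W → Pred Formula 0ℓ
      sat        : SatTm → W → Pred Formula 0ℓ
      val-mono   : ∀ {w v} p → w ≤ v → val p w ≡ true → val p v ≡ true
      prf-mono   : ∀ {w v} t → w ≤ v → prf t w ⊆ prf t v
      sat-mono   : ∀ {w v} m → w ≤ v → sat m w ⊆ sat m v
      prf-·      : ∀ w s t → prf s w ⊙ prf t w ⊆ prf (s · t) w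
      sat-⋆      : ∀ w s m → prf s w ⊙ sat m w ⊆ sat (s ⋆ m) w
      prf-+      : ∀ w s t → prf s w ∪ prf t w ⊆ prf (s + t) w
      sat-⊔      : ∀ w m n → sat m w ∪ sat n w ⊆ sat (m ⊔ n) w
      prf-can    : ∀ w {t A} → [ t ] A ∈ Can CS → A ∈ prf t w
      sat-∨      : ∀ w m {A B} → A ∨ B ∈ sat m w → A ∈ sat m w ⊎ B ∈ sat m w
      prf-▷      : ∀ w m t {A B} →
                   (∀ v → w ≤ v → A ∉ sat m v ⊎ B ∈ prf t v) →
                   A ⇒ B ∈ prf (m ▷ t) w
      sat-⊥      : ∀ w m → ⊥ᶠ ∉ sat m w

    infix 3 _⊩_

    _⊩_ : W → Formula → Set
    w ⊩ atom p  = val p w ≡ true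
    w ⊩ ⊥ᶠ      = ⊥
    w ⊩ A ∧ B   = w ⊩ A × w ⊩ B
    w ⊩ A ∨ B   = w ⊩ A ⊎ w ⊩ B
    w ⊩ A ⇒ B   = ∀ v → w ≤ v → v ⊩ A → v ⊩ B
    w ⊩ [ t ] A = A ∈ prf t w
    w ⊩ ⟨ m ⟩ A = A ∈ sat m w

  ----------------------------------------------------------------------
  -- Modular models

  record QuasiModel (CS : Pred Formula 0ℓ) : Set₁ where
    field
      basic : BasicModel CS
    open BasicModel basic public
    field
      R : Rel W 0ℓ

  record IsBirelational {W : Set} (_≤_ R : Rel W 0ℓ)
                        (val : PropVar → W → Bool) : Set where
    field
      isPreorder : IsPreorder _≡_ _≤_
      monotone   : ∀ {w v} p → w ≤ v → val p w ≡ true → val p v ≡ true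
      BC         : ∀ {w v v′} → R w v → v ≤ v′ → ∃[ w′ ] (w ≤ w′ × R w′ v′)
      FC         : ∀ {w w′ v} → w ≤ w′ → R w v → ∃[ v′ ] (R w′ v′ × v ≤ v′)

  record ModularModel (CS : Pred Formula 0ℓ) : Set₁ where
    field
      quasi : QuasiModel CS
    open QuasiModel quasi public
    field
      isBirelational : IsBirelational _≤_ R val
      JYB : ∀ w t {A} → A ∈ prf t w → ∀ {w′ v′} → w ≤ w′ → R w′ v′ → v′ ⊩ A
      SYP : ∀ w m {A} → A ∈ sat m w → ∃[ v ] (R w v × v ⊩ A)

  -- Validity in all modular models for CS.
  ⊨ₘ : Pred Formula 0ℓ → Formula → Set₁
  ⊨ₘ CS A = (ℳ : ModularModel CS) → let open ModularModel ℳ in ∀ w → w ⊩ A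

{-# OPTIONS --safe #-}
-- Canonical model.  The worlds are the prime theories, ordered by inclusion,
-- with A ∈ prf t w iff [ t ] A ∈ w and A ∈ sat m w iff ⟨ m ⟩ A ∈ w.
-- The relation R w v requires that v contains every A with [ t ] A ∈ w for
-- some t and that every A ∈ v is possible at w.  Reading "possible" as
-- "⟨ m ⟩ A ∈ w for some m" obstructs BC: terms m for infinitely many A must
-- then be chosen jointly consistent with w.  Instead, A is possible at w when
-- w contains every G that follows from ⟨ m ⟩ A for all m, i.e. contains the
-- supremum of the formulas ⟨ m ⟩ A.  This supremum behaves like ◇ A: it
-- distributes over ∨ and is monotone under boxed implications, and if w
-- proves G ⇒ [ t ] B for some such G, then it proves [ m ▷ t ] (A ⇒ B) for
-- any m, which gives BC.
module Submission where

open import Defs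
open import Axiom.ExcludedMiddle using (ExcludedMiddle)
open import Data.Bool using (Bool; true)
open import Data.Empty using (⊥-elim)
open import Data.List using (List; []; _∷_; concat; map; cartesianProductWith)
open import Data.List.Membership.Propositional using () renaming (_∈_ to _∈ˡ_)
open import Data.List.Membership.Propositional.Properties
  using (∈-concat⁺′; ∈-map⁺; ∈-cartesianProductWith⁺)
open import Data.List.Relation.Unary.Any using (here; there)
open import Data.Nat using (ℕ; zero; suc; _≤_; _≤′_; ≤′-refl; ≤′-step; _⊔_)
open import Data.Nat.Properties using (≤⇒≤′; m≤m⊔n; m≤n⊔m)
open import Data.Product using (∃-syntax; _×_; _,_; proj₁)
open import Data.Sum using (_⊎_; inj₁; inj₂)
import Data.Sum as Sum
open import Function.Base using (_∘_)
open import Function.Bundles using (_↣_; module Injection; module Equivalence)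
open import Level using (0ℓ)
open import Relation.Binary.PropositionalEquality
  using (_≡_; refl; sym; cong₂; subst; isEquivalence)
open import Relation.Nullary using (¬_; yes; no; does)
open import Relation.Nullary.Decidable using (decidable-stable; dec-true)
open import Relation.Unary using (Pred; _∈_; _∉_; _⊆_; _∪_; ∅; ｛_｝)

Cumulative : (ℕ → Set) → Set
Cumulative F = ∀ n → F n → F (suc n)

cumulative-≤ : ∀ {F} → Cumulative F → ∀ {m n} → m ≤ n → F m → F n
cumulative-≤ {F} step m≤n = go (≤⇒≤′ m≤n)
  where
  go : ∀ {m n} → m ≤′ n → F m → F n
  go ≤′-refl       p = p
  go (≤′-step m≤n) p = step _ (go m≤n p)

common : ∀ {F G : ℕ → Set} → Cumulative F → Cumulative G →
         ∃[ m ] F m → ∃[ n ] G n → ∃[ k ] (F k × G k)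
common {F} {G} stepF stepG (m , p) (n , q) =
  m ⊔ n , cumulative-≤ {F} stepF (m≤m⊔n m n) p
        , cumulative-≤ {G} stepG (m≤n⊔m m n) q

-- Enumeration of terms and formulas.

module Enumeration (em : ExcludedMiddle 0ℓ) (𝒮 : Signature) where
  open Signature 𝒮
  open Language 𝒮 hiding (_⊔_)
  open Language 𝒮 using () renaming (_⊔_ to _⊔ᵗ_)

  module _ {X : Set} (code : X ↣ ℕ) where
    open Injection code using (to; injective)

    decode : ℕ → List X
    decode n with em {∃[ x ] to x ≡ n}
    ... | yes (x , _) = x ∷ []
    ... | no _        = []

    ∈-decode : ∀ x → x ∈ˡ decode (to x)
    ∈-decode x with em {∃[ y ] to y ≡ to x}
    ... | yes (y , eq) = here (injective (sym eq))
    ... | no ∄         = ⊥-elim (∄ (x , refl))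

    decode-complete : ∀ x → ∃[ n ] x ∈ˡ decode n
    decode-complete x = to x , ∈-decode x

  mutual
    prfTms : ℕ → List PrfTm
    prfTms zero    = []
    prfTms (suc n) = concat (prfParts n)

    -- The first part repeats the previous level, which makes the levels cumulative; each other part
    -- belongs to one term constructor, and the patterns `#0` to `#7` select a part.
    prfParts : ℕ → List (List PrfTm)
    prfParts n =
        prfTms n
      ∷ map con (decode PrfConst-countable n)
      ∷ map var (decode PrfVar-countable n)
      ∷ cartesianProductWith _·_ (prfTms n) (prfTms n)
      ∷ cartesianProductWith _+_ (prfTms n) (prfTms n)
      ∷ map !_ (prfTms n)
      ∷ cartesianProductWith _▷_ (satTms n) (prfTms n)
      ∷ []

    satTms : ℕ → List SatTm
    satTms zero    = []
    satTms (suc n) = concat (satParts n)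

    satParts : ℕ → List (List SatTm)
    satParts n =
        satTms n
      ∷ map var (decode SatVar-countable n)
      ∷ cartesianProductWith _⊔ᵗ_ (satTms n) (satTms n)
      ∷ cartesianProductWith _⋆_ (prfTms n) (satTms n)
      ∷ []

  mutual
    formulas : ℕ → List Formula
    formulas zero    = []
    formulas (suc n) = concat (formulaParts n)

    formulaParts : ℕ → List (List Formula)
    formulaParts n =
        formulas n
      ∷ map atom (decode PropVar-countable n)
      ∷ (⊥ᶠ ∷ [])
      ∷ cartesianProductWith _∧_ (formulas n) (formulas n)
      ∷ cartesianProductWith _∨_ (formulas n) (formulas n)
      ∷ cartesianProductWith _⇒_ (formulas n) (formulas n)
      ∷ cartesianProductWith [_]_ (prfTms n) (formulas n)
      ∷ cartesianProductWith ⟨_⟩_ (satTms n) (formulas n)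
      ∷ []

  pattern #0 = here refl
  pattern #1 = there #0
  pattern #2 = there #1
  pattern #3 = there #2
  pattern #4 = there #3
  pattern #5 = there #4
  pattern #6 = there #5
  pattern #7 = there #6

  prfTms-cumulative : ∀ t → Cumulative (λ n → t ∈ˡ prfTms n)
  prfTms-cumulative t n p = ∈-concat⁺′ {xss = prfParts n} p #0

  satTms-cumulative : ∀ m → Cumulative (λ n → m ∈ˡ satTms n)
  satTms-cumulative m n p = ∈-concat⁺′ {xss = satParts n} p #0

  formulas-cumulative : ∀ A → Cumulative (λ n → A ∈ˡ formulas n)
  formulas-cumulative A n p = ∈-concat⁺′ {xss = formulaParts n} p #0

  mutual
    prfTms-complete : ∀ t → ∃[ n ] t ∈ˡ prfTms n
    prfTms-complete (con c) with n , p ← decode-complete PrfConst-countable c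
      = suc n , ∈-concat⁺′ {xss = prfParts n} (∈-map⁺ con p) #1
    prfTms-complete (var x) with n , p ← decode-complete PrfVar-countable x
      = suc n , ∈-concat⁺′ {xss = prfParts n} (∈-map⁺ var p) #2
    prfTms-complete (s · t)
      with n , p , q ← common (prfTms-cumulative s) (prfTms-cumulative t)
                              (prfTms-complete s) (prfTms-complete t)
      = suc n , ∈-concat⁺′ {xss = prfParts n} (∈-cartesianProductWith⁺ _·_ p q) #3
    prfTms-complete (s + t)
      with n , p , q ← common (prfTms-cumulative s) (prfTms-cumulative t)
                              (prfTms-complete s) (prfTms-complete t)
      = suc n , ∈-concat⁺′ {xss = prfParts n} (∈-cartesianProductWith⁺ _+_ p q) #4
    prfTms-complete (! t) with n , p ← prfTms-complete t
      = suc n , ∈-concat⁺′ {xss = prfParts n} (∈-map⁺ !_ p) #5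
    prfTms-complete (m ▷ t)
      with n , p , q ← common (satTms-cumulative m) (prfTms-cumulative t)
                              (satTms-complete m) (prfTms-complete t)
      = suc n , ∈-concat⁺′ {xss = prfParts n} (∈-cartesianProductWith⁺ _▷_ p q) #6

    satTms-complete : ∀ m → ∃[ n ] m ∈ˡ satTms n
    satTms-complete (var a) with n , p ← decode-complete SatVar-countable a
      = suc n , ∈-concat⁺′ {xss = satParts n} (∈-map⁺ var p) #1
    satTms-complete (l ⊔ᵗ m)
      with n , p , q ← common (satTms-cumulative l) (satTms-cumulative m)
                              (satTms-complete l) (satTms-complete m)
      = suc n , ∈-concat⁺′ {xss = satParts n} (∈-cartesianProductWith⁺ _⊔ᵗ_ p q) #2
    satTms-complete (t ⋆ m)
      with n , p , q ← common (prfTms-cumulative t) (satTms-cumulative m)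
                              (prfTms-complete t) (satTms-complete m)
      = suc n , ∈-concat⁺′ {xss = satParts n} (∈-cartesianProductWith⁺ _⋆_ p q) #3

  formulas-complete : ∀ A → ∃[ n ] A ∈ˡ formulas n
  formulas-complete (atom p) with n , p ← decode-complete PropVar-countable p
    = suc n , ∈-concat⁺′ {xss = formulaParts n} (∈-map⁺ atom p) #1
  formulas-complete ⊥ᶠ = 1 , ∈-concat⁺′ {xss = formulaParts 0} #0 #2
  formulas-complete (A ∧ B)
    with n , p , q ← common (formulas-cumulative A) (formulas-cumulative B)
                            (formulas-complete A) (formulas-complete B)
    = suc n , ∈-concat⁺′ {xss = formulaParts n} (∈-cartesianProductWith⁺ _∧_ p q) #3
  formulas-complete (A ∨ B)
    with n , p , q ← common (formulas-cumulative A) (formulas-cumulative B)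
                            (formulas-complete A) (formulas-complete B)
    = suc n , ∈-concat⁺′ {xss = formulaParts n} (∈-cartesianProductWith⁺ _∨_ p q) #4
  formulas-complete (A ⇒ B)
    with n , p , q ← common (formulas-cumulative A) (formulas-cumulative B)
                            (formulas-complete A) (formulas-complete B)
    = suc n , ∈-concat⁺′ {xss = formulaParts n} (∈-cartesianProductWith⁺ _⇒_ p q) #5
  formulas-complete ([ t ] A)
    with n , p , q ← common (prfTms-cumulative t) (formulas-cumulative A)
                            (prfTms-complete t) (formulas-complete A)
    = suc n , ∈-concat⁺′ {xss = formulaParts n} (∈-cartesianProductWith⁺ [_]_ p q) #6
  formulas-complete (⟨ m ⟩ A)
    with n , p , q ← common (satTms-cumulative m) (formulas-cumulative A)
                            (satTms-complete m) (formulas-complete A)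
    = suc n , ∈-concat⁺′ {xss = formulaParts n} (∈-cartesianProductWith⁺ ⟨_⟩_ p q) #7

module Canonical
  (em : ExcludedMiddle 0ℓ) (𝒮 : Signature)
  (Int : List Scheme) (ipl : AxiomatisesIPL Int)
  (CS : Pred (Language.Formula 𝒮) 0ℓ)
  (appropriate : Language.AxiomaticallyAppropriate 𝒮 Int CS)
  where

  open Language 𝒮 hiding (_⊔_)
  open Language 𝒮 using () renaming (_⊔_ to _⊔ᵗ_)
  open JIK Int CS
  open Enumeration em 𝒮 using (formulas; formulas-complete)

  -- Derivability from arbitrary sets of formulas.

  infix 4 _⊢*_

  data _⊢*_ (P : Pred Formula 0ℓ) : Formula → Set where
    ax  : ∀ {A} → A ∈ Base Int → P ⊢* A
    hyp : ∀ {A} → A ∈ P → P ⊢* A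
    mp  : ∀ {A B} → P ⊢* A → P ⊢* A ⇒ B → P ⊢* B
    can : ∀ {A} → A ∈ Can CS → P ⊢* A

  ⊢*⇒⊢ : ∀ {A} → ∅ ⊢* A → [] ⊢ A
  ⊢*⇒⊢ (ax a)   = ax a
  ⊢*⇒⊢ (mp d e) = mp (⊢*⇒⊢ d) (⊢*⇒⊢ e)
  ⊢*⇒⊢ (can c)  = can c

  cut : ∀ {P Q A} → (∀ {B} → B ∈ P → Q ⊢* B) → P ⊢* A → Q ⊢* A
  cut f (ax a)   = ax a
  cut f (hyp p)  = f p
  cut f (mp d e) = mp (cut f d) (cut f e)
  cut f (can c)  = can c

  weaken : ∀ {P Q A} → P ⊆ Q → P ⊢* A → Q ⊢* A
  weaken P⊆Q = cut (hyp ∘ P⊆Q)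

  weaken-∅ : ∀ {P A} → ∅ ⊢* A → P ⊢* A
  weaken-∅ = cut λ ()

  -- Propositional reasoning.

  instantiate-⟦⟧ : ∀ σ τ φ →
    instantiate σ (φ ⟦ τ ⟧) ≡ instantiate (instantiate σ ∘ τ) φ
  instantiate-⟦⟧ σ τ (meta i) = refl
  instantiate-⟦⟧ σ τ ⊥ᶠ       = refl
  instantiate-⟦⟧ σ τ (φ ∧ ψ)  = cong₂ _∧_ (instantiate-⟦⟧ σ τ φ) (instantiate-⟦⟧ σ τ ψ)
  instantiate-⟦⟧ σ τ (φ ∨ ψ)  = cong₂ _∨_ (instantiate-⟦⟧ σ τ φ) (instantiate-⟦⟧ σ τ ψ)
  instantiate-⟦⟧ σ τ (φ ⇒ ψ)  = cong₂ _⇒_ (instantiate-⟦⟧ σ τ φ) (instantiate-⟦⟧ σ τ ψ)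

  ⊢ₕ⇒⊢* : ∀ {P φ} σ → Int ⊢ₕ φ → P ⊢* instantiate σ φ
  ⊢ₕ⇒⊢* {P} σ (ax {φ} φ∈Int τ) =
    subst (P ⊢*_) (sym (instantiate-⟦⟧ σ τ φ)) (ax (int φ∈Int (instantiate σ ∘ τ)))
  ⊢ₕ⇒⊢* σ (mp d e) = mp (⊢ₕ⇒⊢* σ d) (⊢ₕ⇒⊢* σ e)

  private
    a b c : Scheme
    a = meta 0
    b = meta 1
    c = meta 2

  -- `AxiomatisesIPL` speaks of schemes only, so a natural deduction proof is first turned into a
  -- Hilbert proof and then instantiated. Metavariables beyond the first two are all sent to `C`.
  theorem-of-IPL : ∀ φ → [] ⊢ₙ φ → ∀ A B C {P} →
    P ⊢* instantiate (λ { 0 → A ; 1 → B ; _ → C }) φ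
  theorem-of-IPL φ d A B C = ⊢ₕ⇒⊢* _ (Equivalence.from (ipl φ) d)

  private
    h₀ : ∀ {Γ φ} → φ ∷ Γ ⊢ₙ φ
    h₀ = hyp (here refl)

    h₁ : ∀ {Γ φ ψ} → ψ ∷ φ ∷ Γ ⊢ₙ φ
    h₁ = hyp (there (here refl))

    h₂ : ∀ {Γ φ ψ χ} → χ ∷ ψ ∷ φ ∷ Γ ⊢ₙ φ
    h₂ = hyp (there (there (here refl)))

    h₃ : ∀ {Γ φ ψ χ θ} → θ ∷ χ ∷ ψ ∷ φ ∷ Γ ⊢ₙ φ
    h₃ = hyp (there (there (there (here refl))))

  K : ∀ {P A B} → P ⊢* A ⇒ B ⇒ A
  K {A = A} {B} = theorem-of-IPL (a ⇒ b ⇒ a) (⇒-i (⇒-i h₁)) A B B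

  S : ∀ {P A B C} → P ⊢* (A ⇒ B ⇒ C) ⇒ (A ⇒ B) ⇒ A ⇒ C
  S {A = A} {B} {C} = theorem-of-IPL ((a ⇒ b ⇒ c) ⇒ (a ⇒ b) ⇒ a ⇒ c)
    (⇒-i (⇒-i (⇒-i (⇒-e (⇒-e h₂ h₀) (⇒-e h₁ h₀))))) A B C

  deduction : ∀ {P A B} → P ∪ ｛ A ｝ ⊢* B → P ⊢* A ⇒ B
  deduction (ax x)            = mp (ax x) K
  deduction (hyp (inj₁ p))    = mp (hyp p) K
  deduction {A = A} (hyp (inj₂ refl)) =
    theorem-of-IPL (a ⇒ a) (⇒-i h₀) A A A
  deduction (mp d e)          = mp (deduction d) (mp (deduction e) S)
  deduction (can x)           = mp (can x) K

  ⇒-elim : ∀ {P A B} → P ⊢* A ⇒ B → P ∪ ｛ A ｝ ⊢* B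
  ⇒-elim d = mp (hyp (inj₂ refl)) (weaken inj₁ d)

  ∧-intro : ∀ {P A B} → P ⊢* A → P ⊢* B → P ⊢* A ∧ B
  ∧-intro {A = A} {B} d e =
    mp e (mp d (theorem-of-IPL (a ⇒ b ⇒ a ∧ b) (⇒-i (⇒-i (∧-i h₁ h₀))) A B B))

  ∧-fst : ∀ {P A B} → P ⊢* A ∧ B ⇒ A
  ∧-fst {A = A} {B} = theorem-of-IPL (a ∧ b ⇒ a) (⇒-i (∧-e₁ h₀)) A B B

  ∧-snd : ∀ {P A B} → P ⊢* A ∧ B ⇒ B
  ∧-snd {A = A} {B} = theorem-of-IPL (a ∧ b ⇒ b) (⇒-i (∧-e₂ h₀)) A B B

  ∨-inl : ∀ {P A B} → P ⊢* A ⇒ A ∨ B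
  ∨-inl {A = A} {B} = theorem-of-IPL (a ⇒ a ∨ b) (⇒-i (∨-i₁ h₀)) A B B

  ∨-inr : ∀ {P A B} → P ⊢* B ⇒ A ∨ B
  ∨-inr {A = A} {B} = theorem-of-IPL (b ⇒ a ∨ b) (⇒-i (∨-i₂ h₀)) A B B

  ∨-elim : ∀ {P A B C} → P ⊢* A ⇒ C → P ⊢* B ⇒ C → P ⊢* A ∨ B ⇒ C
  ∨-elim {A = A} {B} {C} d e = mp e (mp d
    (theorem-of-IPL ((a ⇒ c) ⇒ (b ⇒ c) ⇒ a ∨ b ⇒ c)
      (⇒-i (⇒-i (⇒-i (∨-e h₀ (⇒-e h₃ h₀) (⇒-e h₂ h₀))))) A B C))

  ⊥-elim* : ∀ {P A} → P ⊢* ⊥ᶠ ⇒ A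
  ⊥-elim* {A = A} = theorem-of-IPL (⊥ᶠ ⇒ a) (⇒-i (⊥-e h₀)) A A A

  ⇒-trans : ∀ {P A B C} → P ⊢* A ⇒ B → P ⊢* B ⇒ C → P ⊢* A ⇒ C
  ⇒-trans d e = deduction (mp (⇒-elim d) (weaken inj₁ e))

  -- Internalisation of derivations by proof terms.

  internalise : ∀ {P Q A} → (∀ {B} → B ∈ P → ∃[ t ] Q ⊢* [ t ] B) →
                P ⊢* A → ∃[ t ] Q ⊢* [ t ] A
  -- Axiomatic appropriateness supplies the constant that justifies an axiom.
  internalise f (ax x) with c , cA∈CS ← appropriate x = con c , can (can cA∈CS 0)
  internalise f (hyp p) = f p
  internalise f (mp {A} {B} d e)
    with t , d′ ← internalise f d | s , e′ ← internalise f e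
    = s · t , mp d′ (mp e′ (ax (k□ s t A B)))
  -- A conclusion of `can` is justified by the next instance of `can`, with one more `!`.
  internalise f (can (can {c} cA∈CS k)) = !^ (suc k) (con c) , can (can cA∈CS (suc k))

  necessitation : ∀ {P A} → ∅ ⊢* A → ∃[ t ] P ⊢* [ t ] A
  necessitation = internalise λ ()

  □-monotone : ∀ {P A B} t → ∅ ⊢* A ⇒ B → ∃[ s ] P ⊢* [ t ] A ⇒ [ s ] B
  □-monotone t d with s , e ← necessitation d = s · t , mp e (ax (k□ s t _ _))

  -- The members of `Q` used in a derivation merge into one conjunction; `A₀` is the default for
  -- steps that use none.
  compress : ∀ {P Q : Pred Formula 0ℓ} {B} → ∃[ A ] A ∈ Q →
             (∀ {A A′} → A ∈ Q → A′ ∈ Q → A ∧ A′ ∈ Q) →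
             P ∪ Q ⊢* B → ∃[ A ] (A ∈ Q × P ⊢* A ⇒ B)
  compress {P} {Q} (A₀ , A₀∈Q) ∧-closed = go
    where
    go : ∀ {B} → P ∪ Q ⊢* B → ∃[ A ] (A ∈ Q × P ⊢* A ⇒ B)
    go (ax x)             = A₀ , A₀∈Q , mp (ax x) K
    go (hyp (inj₁ p))     = A₀ , A₀∈Q , mp (hyp p) K
    go (hyp {B} (inj₂ q)) = B , q , deduction (hyp (inj₂ refl))
    go (can x)            = A₀ , A₀∈Q , mp (can x) K
    go (mp d e) with A , p , d′ ← go d | A′ , p′ , e′ ← go e
      = A ∧ A′ , ∧-closed p p′ , mp (⇒-trans ∧-fst d′) (mp (⇒-trans ∧-snd e′) S)

  -- Prime theories.

  -- A world stores a Boolean function, not a predicate, so that World : Set.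
  record World : Set where
    field
      member     : Formula → Bool
      closed     : ∀ {A} → (λ B → member B ≡ true) ⊢* A → member A ≡ true
      prime      : ∀ {A B} → member (A ∨ B) ≡ true → member A ≡ true ⊎ member B ≡ true
      consistent : ¬ member ⊥ᶠ ≡ true

    theory : Pred Formula 0ℓ
    theory A = member A ≡ true

  open World using (member; theory; closed; prime; consistent)

  detach : ∀ w {A B} → A ⇒ B ∈ theory w → A ∈ theory w → B ∈ theory w
  detach w p q = closed w (mp (hyp q) (hyp p))

  theorem-in : ∀ w {A} → ∅ ⊢* A → A ∈ theory w
  theorem-in w d = closed w (weaken-∅ d)

  theory-∧ : ∀ v {A B} → A ∈ theory v → B ∈ theory v → A ∧ B ∈ theory v
  theory-∧ v p q = closed v (∧-intro (hyp p) (hyp q))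

  fromPrime : (P : Pred Formula 0ℓ) →
    (∀ {A} → P ⊢* A → A ∈ P) → (∀ {A B} → A ∨ B ∈ P → A ∈ P ⊎ B ∈ P) → ⊥ᶠ ∉ P →
    ∃[ w ] (P ⊆ theory w × theory w ⊆ P)
  fromPrime P P-closed P-prime P-consistent = w , enter , leave
    where
    mem : Formula → Bool
    mem A = does (em {A ∈ P})

    enter : ∀ {A} → A ∈ P → mem A ≡ true
    enter {A} = dec-true (em {A ∈ P})

    leave : ∀ {A} → mem A ≡ true → A ∈ P
    leave {A} eq with em {A ∈ P}
    ... | yes p = p

    w : World
    w = record
      { member     = mem
      ; closed     = λ d → enter (P-closed (weaken leave d))
      ; prime      = λ p → Sum.map enter enter (P-prime (leave p))
      ; consistent = λ p → P-consistent (leave p)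
      }

  -- Lindenbaum construction relative to an ideal.

  module Separation
    (P I : Pred Formula 0ℓ)
    (I-⊥ : ⊥ᶠ ∈ I) (I-∨ : ∀ {A B} → A ∈ I → B ∈ I → A ∨ B ∈ I)
    where

    Avoids : Pred Formula 0ℓ → Set
    Avoids Q = ∀ {A} → A ∈ I → ¬ Q ⊢* A

    -- Safety of the addition is part of the membership condition, so the set is defined without a
    -- case distinction.
    add : Pred Formula 0ℓ → Formula → Pred Formula 0ℓ
    add Q A = Q ∪ λ B → A ≡ B × Avoids (Q ∪ ｛ A ｝)

    addAll : Pred Formula 0ℓ → List Formula → Pred Formula 0ℓ
    addAll Q []       = Q
    addAll Q (A ∷ As) = addAll (add Q A) As

    addAll-⊇ : ∀ {Q} As → Q ⊆ addAll Q As
    addAll-⊇ []       p = p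
    addAll-⊇ (A ∷ As) p = addAll-⊇ As (inj₁ p)

    add-avoids : ∀ {Q} A → Avoids Q → Avoids (add Q A)
    add-avoids {Q} A avoids i d with em {Avoids (Q ∪ ｛ A ｝)}
    ... | yes avoids′ = avoids′ i (weaken (λ { (inj₁ q) → inj₁ q ; (inj₂ (eq , _)) → inj₂ eq }) d)
    ... | no  ¬avoids = avoids i (weaken (λ { (inj₁ q) → q ; (inj₂ (_ , av)) → ⊥-elim (¬avoids av) }) d)

    addAll-avoids : ∀ {Q} As → Avoids Q → Avoids (addAll Q As)
    addAll-avoids []       avoids = avoids
    addAll-avoids (A ∷ As) avoids = addAll-avoids As (add-avoids A avoids)

    Refutes : Pred Formula 0ℓ → Formula → Set
    Refutes Q A = ∃[ B ] (B ∈ I × Q ⊢* A ⇒ B)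

    add-decides : ∀ Q A → A ∈ add Q A ⊎ Refutes Q A
    add-decides Q A with em {Refutes Q A}
    ... | yes r = inj₂ r
    ... | no ¬r = inj₁ (inj₂ (refl , λ i d → ¬r (_ , i , deduction d)))

    addAll-decides : ∀ Q {A} As → A ∈ˡ As → A ∈ addAll Q As ⊎ Refutes (addAll Q As) A
    addAll-decides Q (A ∷ As) (here refl) with add-decides Q A
    ... | inj₁ p           = inj₁ (addAll-⊇ As p)
    ... | inj₂ (B , i , d) = inj₂ (B , i , weaken (addAll-⊇ As ∘ inj₁) d)
    addAll-decides Q (A ∷ As) (there p) = addAll-decides (add Q A) As p

    stage : ℕ → Pred Formula 0ℓ
    stage zero    = P
    stage (suc n) = addAll (stage n) (formulas n)

    limit : Pred Formula 0ℓ
    limit A = ∃[ n ] stage n ⊢* A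

    stage-cumulative : ∀ A → Cumulative (λ n → stage n ⊢* A)
    stage-cumulative A n = weaken (addAll-⊇ (formulas n))

    stage-common : ∀ {A B} → A ∈ limit → B ∈ limit → ∃[ n ] (stage n ⊢* A × stage n ⊢* B)
    stage-common {A} {B} = common (stage-cumulative A) (stage-cumulative B)

    limit-closed : ∀ {A} → limit ⊢* A → A ∈ limit
    limit-closed (ax x)  = 0 , ax x
    limit-closed (hyp p) = p
    limit-closed (mp d e) with n , d′ , e′ ← stage-common (limit-closed d) (limit-closed e)
      = n , mp d′ e′
    limit-closed (can x) = 0 , can x

    limit-decides : ∀ A → A ∈ limit ⊎ Refutes limit A
    limit-decides A with n , p ← formulas-complete A
      with addAll-decides (stage n) (formulas n) p
    ... | inj₁ q           = inj₁ (suc n , hyp q)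
    ... | inj₂ (B , i , d) = inj₂ (B , i , hyp (suc n , d))

    module _ (P-avoids : Avoids P) where

      stage-avoids : ∀ n → Avoids (stage n)
      stage-avoids zero    = P-avoids
      stage-avoids (suc n) = addAll-avoids (formulas n) (stage-avoids n)

      limit-avoids : ∀ {A} → A ∈ I → A ∉ limit
      limit-avoids i (n , d) = stage-avoids n i d

      -- If both disjuncts are left out, each implies a member of `I`; by `I-∨` so does the
      -- disjunction, and the limit would meet `I`.
      limit-prime : ∀ {A B} → A ∨ B ∈ limit → A ∈ limit ⊎ B ∈ limit
      limit-prime {A} {B} p with limit-decides A | limit-decides B
      ... | inj₁ q | _      = inj₁ q
      ... | inj₂ _ | inj₁ q = inj₂ q
      ... | inj₂ (C , i , d) | inj₂ (D , j , e) =
        ⊥-elim (limit-avoids (I-∨ i j) (limit-closed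
          (mp (hyp p) (∨-elim (⇒-trans d ∨-inl) (⇒-trans e ∨-inr)))))

      -- Avoiding a set closed under disjunction instead of one formula lets a world leave out all
      -- impossible formulas, or all `[ t ] B` with `B` outside another world, at once.
      separate : ∃[ w ] (P ⊆ theory w × (∀ {A} → A ∈ I → A ∉ theory w))
      separate with w , enter , leave ←
                      fromPrime limit limit-closed limit-prime (limit-avoids I-⊥)
        = w , (λ p → enter (0 , hyp p)) , λ i p → limit-avoids i (leave p)

  open Separation using (separate)

  -- The formula `A` is replaced by all formulas that provably imply it, a set containing `⊥ᶠ` and
  -- closed under disjunction.
  separate-formula : ∀ {P A} → ¬ P ⊢* A → ∃[ w ] (P ⊆ theory w × A ∉ theory w)
  separate-formula {P} {A} ⊬A
    with w , P⊆w , avoids ← separate P (λ C → ∅ ⊢* C ⇒ A) ⊥-elim* ∨-elim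
                              (λ i d → ⊬A (mp d (weaken-∅ i)))
    = w , P⊆w , avoids (deduction (hyp (inj₂ refl)))

  infix 4 _≼_
  _≼_ : World → World → Set
  w ≼ v = theory w ⊆ theory v

  ⇒-in : ∀ w {A B} → (∀ v → w ≼ v → A ∈ theory v → B ∈ theory v) → A ⇒ B ∈ theory w
  ⇒-in w {A} {B} f with em {theory w ∪ ｛ A ｝ ⊢* B}
  ... | yes d = closed w (deduction d)
  ... | no ⊬B with v , w,A⊆v , B∉v ← separate-formula ⊬B
    = ⊥-elim (B∉v (f v (w,A⊆v ∘ inj₁) (w,A⊆v (inj₂ refl))))

  -- Necessity and possibility at a world.

  □⁻¹ : World → Pred Formula 0ℓ
  □⁻¹ w A = ∃[ t ] [ t ] A ∈ theory w

  □⁻¹-closed : ∀ w {A} → □⁻¹ w ⊢* A → A ∈ □⁻¹ w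
  □⁻¹-closed w d with t , e ← internalise (λ (t , p) → t , hyp p) d = t , closed w e

  -- Provability from `∅`, not from a world, makes `Possible` grow along `≼`, as `R-FC` needs.
  Bound : Formula → Pred Formula 0ℓ
  Bound A G = ∀ m → ∅ ⊢* ⟨ m ⟩ A ⇒ G

  Possible : World → Pred Formula 0ℓ
  Possible w A = Bound A ⊆ theory w

  -- A justified projection turns `⟨ m ⟩ (A ∧ B)` into `⟨ s ⋆ m ⟩` of either conjunct; the change of
  -- term is harmless because bounds hold for all terms.
  bound-∧ : ∀ {A B G H} → G ∈ Bound A → H ∈ Bound B → G ∧ H ∈ Bound (A ∧ B)
  bound-∧ {A} {B} {G} {H} g h m = deduction (∧-intro (component ∧-fst g) (component ∧-snd h))
    where
    component : ∀ {C F} → ∅ ⊢* A ∧ B ⇒ C → F ∈ Bound C → ∅ ∪ ｛ ⟨ m ⟩ (A ∧ B) ｝ ⊢* F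
    component d f with s , e ← necessitation d =
      mp (mp (hyp (inj₂ refl)) (mp e (ax (k◇ s m _ _)))) (weaken-∅ (f (s ⋆ m)))

  possible-⟨⟩ : ∀ w {m A} → ⟨ m ⟩ A ∈ theory w → A ∈ Possible w
  possible-⟨⟩ w {m} p g = detach w (theorem-in w (g m)) p

  possible-⊥ : ∀ w → ⊥ᶠ ∉ Possible w
  possible-⊥ w p = consistent w (p (λ m → ax (◇⊥ m)))

  -- If `w` omits a bound of `A` and a bound of `B`, it still contains their disjunction, a bound of
  -- `A ∨ B`, against primality.
  possible-∨ : ∀ w {A B} → A ∨ B ∈ Possible w → A ∈ Possible w ⊎ B ∈ Possible w
  possible-∨ w {A} {B} p with em {A ∈ Possible w} | em {B ∈ Possible w}
  ... | yes q | _     = inj₁ q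
  ... | no  _ | yes q = inj₂ q
  ... | no ¬q | no ¬r = ⊥-elim (¬q λ g →
    decidable-stable em λ G∉w → ¬r λ h → resolve G∉w (prime w (p (bound g h))))
    where
    bound : ∀ {G H} → G ∈ Bound A → H ∈ Bound B → G ∨ H ∈ Bound (A ∨ B)
    bound g h m = ⇒-trans (ax (◇∨ m A B))
      (∨-elim (⇒-trans (g m) ∨-inl) (⇒-trans (h m) ∨-inr))
    resolve : ∀ {X Y : Set} → ¬ X → X ⊎ Y → Y
    resolve ¬x (inj₁ x) = ⊥-elim (¬x x)
    resolve ¬x (inj₂ y) = y

  -- If `G` bounds `B`, then `[ s ] (A ⇒ B) ⇒ G` bounds `A` by `k◇`; so it lies in `w` and `G` can
  -- be detached.
  possible-□ : ∀ w {A B} → A ⇒ B ∈ □⁻¹ w → A ∈ Possible w → B ∈ Possible w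
  possible-□ w {A} {B} (s , q) p {G} g = detach w (p bound) q
    where
    bound : [ s ] (A ⇒ B) ⇒ G ∈ Bound A
    bound m = deduction (deduction (mp
      (mp (hyp (inj₁ (inj₂ refl))) (mp (hyp (inj₂ refl)) (ax (k◇ s m A B))))
      (weaken-∅ (g (s ⋆ m)))))

  -- Without satisfier terms every formula, `⊥ᶠ` included, would vacuously be a bound and so lie in
  -- `w`.
  possible⇒SatTm : ∀ w {A} → A ∈ Possible w → SatTm
  possible⇒SatTm w p = decidable-stable em λ none → consistent w (p (λ m → ⊥-elim (none m)))

  -- Accessibility relation and its frame conditions.

  R : World → World → Set
  R w v = □⁻¹ w ⊆ theory v × theory v ⊆ Possible w

  ⊤ᶠ : Formula
  ⊤ᶠ = ⊥ᶠ ⇒ ⊥ᶠ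

  -- The set to avoid consists of the formulas not possible at `w`. A consequence of `□⁻¹ w` and `P`
  -- follows from one member of `P` by a boxed implication, hence is possible by `possible-□`.
  R-extend : ∀ w (P : Pred Formula 0ℓ) → ∃[ A ] A ∈ P →
    (∀ {A B} → A ∈ P → B ∈ P → A ∧ B ∈ P) → P ⊆ Possible w →
    ∃[ v ] (R w v × P ⊆ theory v)
  R-extend w P inhabited ∧-closed P-possible
    with v , ⊆v , avoids ← separate (□⁻¹ w ∪ P) (λ A → A ∉ Possible w)
           (possible-⊥ w)
           (λ ¬p ¬q r → Sum.[ ¬p , ¬q ] (possible-∨ w r))
           (λ ¬p d → let A , A∈P , e = compress inhabited ∧-closed d in
              ¬p (possible-□ w (□⁻¹-closed w e) (P-possible A∈P)))
    = v , (⊆v ∘ inj₁ , λ p → decidable-stable em λ ¬q → avoids ¬q p) , ⊆v ∘ inj₂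

  -- The world `w′` extends `w` by all bounds of members of `v′`, which makes these possible, and
  -- avoids everything that provably implies `[ t ] B` for some `B` outside `v′`.
  R-BC : ∀ {w v v′} → R w v → v ≼ v′ → ∃[ w′ ] (w ≼ w′ × R w′ v′)
  R-BC {w} {v} {v′} (□⊆v , v⊆◇) v≼v′ =
    let w′ , ⊆w′ , avoids = separate (theory w ∪ Bounds) Ideal
          (t₀ , ⊥ᶠ , consistent v′ , ⊥-elim*) ideal-∨ disjoint
    in w′ , ⊆w′ ∘ inj₁
     , (λ {A} (t , p) → decidable-stable em λ A∉v′ →
          avoids (t , A , A∉v′ , deduction (hyp (inj₂ refl))) p)
     , λ {A} p {G} g → ⊆w′ (inj₂ (A , p , g))
    where
    -- Any proof term would place `⊥ᶠ` in `Ideal`; boxing a theorem yields one even without proof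
    -- variables.
    t₀ = proj₁ (necessitation {∅} (K {A = ⊤ᶠ} {⊤ᶠ}))
    -- A satisfier term exists because `v` contains `⊤ᶠ`, which is therefore possible at `w`.
    m₀ = possible⇒SatTm w (v⊆◇ (theorem-in v (⊥-elim* {A = ⊥ᶠ})))

    Bounds : Pred Formula 0ℓ
    Bounds G = ∃[ A ] (A ∈ theory v′ × G ∈ Bound A)

    Ideal : Pred Formula 0ℓ
    Ideal C = ∃[ t ] ∃[ B ] (B ∉ theory v′ × ∅ ⊢* C ⇒ [ t ] B)

    -- Both boxes are weakened to boxes of `A ∨ B` and joined by `+`; primality of `v′` keeps
    -- `A ∨ B` out of it.
    ideal-∨ : ∀ {C D} → C ∈ Ideal → D ∈ Ideal → C ∨ D ∈ Ideal
    ideal-∨ (s , A , A∉v′ , d) (t , B , B∉v′ , e)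
      with s′ , d′ ← □-monotone s (∨-inl {A = A} {B})
         | t′ , e′ ← □-monotone t (∨-inr {A = A} {B})
      = s′ + t′ , A ∨ B , (λ p → Sum.[ A∉v′ , B∉v′ ] (prime v′ p))
      , ∨-elim (⇒-trans d (⇒-trans d′ (ax (sumˡ s′ t′ _))))
               (⇒-trans e (⇒-trans e′ (ax (sumʳ s′ t′ _))))

    disjoint : ∀ {C} → C ∈ Ideal → ¬ theory w ∪ Bounds ⊢* C
    disjoint (t , B , B∉v′ , e) d
      with G , (A , A∈v′ , g) , f ←
             compress (⊤ᶠ , ⊤ᶠ , theorem-in v′ ⊥-elim* , λ m → mp ⊥-elim* K)
                      (λ (A , p , g) (B , q , h) → A ∧ B , theory-∧ v′ p q , bound-∧ g h) d
      -- From `⟨ m₀ ⟩ A ⇒ G` and `G ⇒ [ t ] B`, axiom `◇⇒□` puts `[ m₀ ▷ t ] (A ⇒ B)` in `w`, so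
      -- `A ⇒ B` reaches `v` and then `v′`, which would contain `B`.
      = B∉v′ (detach v′ (v≼v′ (□⊆v (m₀ ▷ t , closed w
          (mp (⇒-trans (weaken-∅ (g m₀)) (⇒-trans f (weaken-∅ e))) (ax (◇⇒□ m₀ t A B)))))) A∈v′)

  R-FC : ∀ {w w′ v} → w ≼ w′ → R w v → ∃[ v′ ] (R w′ v′ × v ≼ v′)
  R-FC {w} {w′} {v} w≼w′ (_ , v⊆◇) =
    R-extend w′ (theory v) (⊤ᶠ , theorem-in v ⊥-elim*) (theory-∧ v)
      (λ p g → w≼w′ (v⊆◇ p g))

  -- The seed consists of all consequences of `A`, because `R-extend` asks for closure under
  -- conjunction; each is possible by `necessitation` and `possible-□`.
  R-witness : ∀ w {m A} → ⟨ m ⟩ A ∈ theory w → ∃[ v ] (R w v × A ∈ theory v)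
  R-witness w {m} {A} p =
    let v , wRv , ⊆v = R-extend w Consequence (A , deduction (hyp (inj₂ refl)))
           (λ d e → deduction (∧-intro (⇒-elim d) (⇒-elim e)))
           (λ d → let s , e = necessitation d in
              possible-□ w (s , closed w e) (possible-⟨⟩ w p))
    in v , wRv , ⊆v (deduction (hyp (inj₂ refl)))
    where
    Consequence : Pred Formula 0ℓ
    Consequence B = ∅ ⊢* A ⇒ B

  -- Canonical basic model.

  basicModel : World → BasicModel CS
  basicModel w₀ = record
    { W          = World
    ; inhabitant = w₀
    ; _≤_        = _≼_
    ; isPreorder = record
        { isEquivalence = isEquivalence
        ; reflexive     = λ { refl p → p }
        ; trans         = λ w≼v v≼u p → v≼u (w≼v p)
        }
    ; val      = λ p w → member w (atom p)
    ; prf      = λ t w A → [ t ] A ∈ theory w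
    ; sat      = λ m w A → ⟨ m ⟩ A ∈ theory w
    ; val-mono = λ p w≼v q → w≼v q
    ; prf-mono = λ t w≼v q → w≼v q
    ; sat-mono = λ m w≼v q → w≼v q
    ; prf-·    = λ w s t (A , p , q) → detach w (detach w (theorem-in w (ax (k□ s t A _))) p) q
    ; sat-⋆    = λ w s m (A , p , q) → detach w (detach w (theorem-in w (ax (k◇ s m A _))) p) q
    ; prf-+    = λ w s t → λ { (inj₁ p) → detach w (theorem-in w (ax (sumˡ s t _))) p
                             ; (inj₂ p) → detach w (theorem-in w (ax (sumʳ s t _))) p }
    ; sat-⊔    = λ w m n → λ { (inj₁ p) → detach w (theorem-in w (ax (joinˡ m n _))) p
                             ; (inj₂ p) → detach w (theorem-in w (ax (joinʳ m n _))) p }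
    ; prf-can  = λ w c → theorem-in w (can c)
    ; sat-∨    = λ w m p → prime w (detach w (theorem-in w (ax (◇∨ m _ _))) p)
    ; prf-▷    = λ w m t f → detach w (theorem-in w (ax (◇⇒□ m t _ _)))
        (⇒-in w λ v w≼v p → Sum.[ (λ ¬p → ⊥-elim (¬p p)) , (λ q → q) ] (f v w≼v))
    ; sat-⊥    = λ w m p → consistent w (detach w (theorem-in w (ax (◇⊥ m))) p)
    }

  -- Truth lemma and the canonical modular model.

  module _ (w₀ : World) where
    open BasicModel (basicModel w₀) using (_⊩_)

    mutual
      -- The two directions are mutual because implication swaps them; truth of a modal formula is
      -- membership by definition, so there is no induction under a modality.
      ∈⇒⊩ : ∀ A {w} → A ∈ theory w → w ⊩ A
      ∈⇒⊩ (atom p) q = q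
      ∈⇒⊩ ⊥ᶠ {w} q = consistent w q
      ∈⇒⊩ (A ∧ B) {w} q =
        ∈⇒⊩ A (detach w (theorem-in w ∧-fst) q) , ∈⇒⊩ B (detach w (theorem-in w ∧-snd) q)
      ∈⇒⊩ (A ∨ B) {w} q = Sum.map (∈⇒⊩ A) (∈⇒⊩ B) (prime w q)
      ∈⇒⊩ (A ⇒ B) q v w≼v r = ∈⇒⊩ B (detach v (w≼v q) (⊩⇒∈ A r))
      ∈⇒⊩ ([ t ] A) q = q
      ∈⇒⊩ (⟨ m ⟩ A) q = q

      ⊩⇒∈ : ∀ A {w} → w ⊩ A → A ∈ theory w
      ⊩⇒∈ (atom p) q = q
      ⊩⇒∈ (A ∧ B) {w} (q , r) = theory-∧ w (⊩⇒∈ A q) (⊩⇒∈ B r)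
      ⊩⇒∈ (A ∨ B) {w} (inj₁ q) = detach w (theorem-in w ∨-inl) (⊩⇒∈ A q)
      ⊩⇒∈ (A ∨ B) {w} (inj₂ q) = detach w (theorem-in w ∨-inr) (⊩⇒∈ B q)
      ⊩⇒∈ (A ⇒ B) {w} q = ⇒-in w λ v w≼v r → ⊩⇒∈ B (q v w≼v (∈⇒⊩ A r))
      ⊩⇒∈ ([ t ] A) q = q
      ⊩⇒∈ (⟨ m ⟩ A) q = q

    modularModel : ModularModel CS
    modularModel = record
      { quasi          = record { basic = basicModel w₀ ; R = R }
      ; isBirelational = record
          { isPreorder = BasicModel.isPreorder (basicModel w₀)
          ; monotone   = λ p w≼v q → w≼v q
          ; BC         = λ {w} {v} {v′} → R-BC {w} {v} {v′}
          ; FC         = λ {w} {w′} {v} → R-FC {w} {w′} {v}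
          }
      ; JYB = λ w t {A} p w≼w′ (□⊆v′ , _) → ∈⇒⊩ A (□⊆v′ (t , w≼w′ p))
      ; SYP = λ w m {A} p → let v , wRv , A∈v = R-witness w p in v , wRv , ∈⇒⊩ A A∈v
      }

  -- Completeness by the canonical countermodel.

  completeness : ∀ A → ⊨ₘ CS A → [] ⊢ A
  completeness A valid with em {∅ ⊢* A}
  ... | yes d = ⊢*⇒⊢ d
  ... | no ⊬A with w , _ , A∉w ← separate-formula ⊬A
    = ⊥-elim (A∉w (⊩⇒∈ w A (valid (modularModel w) w)))

theorem4p8 : ExcludedMiddle 0ℓ →
    (𝒮 : Signature) → let open Language 𝒮 in
    (Int : List Scheme) → AxiomatisesIPL Int →
    (CS : Pred Formula 0ℓ) → let open JIK Int CS in
    IsConstantSpecification Int CS →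
    AxiomaticallyAppropriate Int CS →
    (A : Formula) → ⊨ₘ CS A → [] ⊢ A
theorem4p8 em 𝒮 Int ipl CS _ appropriate =
  Canonical.completeness em 𝒮 Int ipl CS appropriate
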